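{- In the $L^1$ norm on $\mathbb{R}^2$, for every positive integer $n\leq 8$ there exists a strong crescent configuration of size $n$.
   Context: Let $\|\cdot\|$ be the $L^1$ (taxicab) norm on $\mathbb{R}^2$, $\|(x,y)\|=|x|+|y|$. A $\|\cdot\|$ circle is a set $\{q\in\mathbb{R}^2:\|q-p\|=r\}$ with $p\in\mathbb{R}^2$, $r>0$. A set $S\subset\mathbb{R}^2$ of $n$ points is a line-like configuration of size $n$ in $\|\cdot\|$ if its distance graph is isomorphic to that of $n$ equally spaced points on a line, i.e. there is a bijection $\phi: S\to\{1,\dots,n\}$ such that for all $a,b,c,d\in S$: $\|a-b\|=\|c-d\|$ if and only if $|\phi(a)-\phi(b)|=|\phi(c)-\phi(d)|$. A set of points lies in strong general position in $\|\cdot\|$ if (1) no three of its points lie on a common line, (2) no four of its points lie on a common $\|\cdot\|$ circle, and (3) no four of its points form a line-like configuration of size four in $\|\cdot\|$. A set of $n$ points in $\mathbb{R}^2$ is a strong crescent configuration of size $n$ in $\|\cdot\|$ if (1) it lies in strong general position in $\|\cdot\|$, (2) it determines exactly $n-1$ distinct (nonzero) distances, measured in $\|\cdot\|$, and (3) for each $1\leq i\leq n-1$ there is a distance which occurs with multiplicity exactly $i$ among the unordered pairs of distinct points. -}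

module Defs where

open import Data.Fin as Fin using (Fin; toℕ)
open import Data.Fin.Permutation using (Permutation′; _⟨$⟩ʳ_)
open import Data.Nat as ℕ using (ℕ; _∸_)
import Data.Nat.Properties as ℕ
open import Data.Product using (∃-syntax; _×_; _,_; proj₁; proj₂)
open import Data.Rational as ℚ using (ℚ; 0ℚ; 1ℚ; ½)
import Data.Rational.Properties as ℚ
open import Data.Rational.Solver using (module +-*-Solver)
open import Data.Sum using (inj₁; inj₂)
open import Function.Base using (_∘_)
open import Function.Bundles using (_⇔_)
open import Function.Definitions using (Injective)
open import Level using (0ℓ)
open import Relation.Binary.Bundles using (Setoid)
open import Relation.Binary.PropositionalEquality
  using (_≡_; _≢_; refl; sym; trans; cong; subst; subst₂; setoid)
open import Relation.Binary.Structures using (IsEquivalence)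
open import Relation.Nullary using (¬_)

-- The standard library has no real numbers.  A real is a Cauchy sequence of
-- rationals; equality of reals is the equivalence relation _≈_ below, and
-- the field operations act termwise.

Seq : Set
Seq = ℕ → ℚ

EventuallyWithin : Seq → ℚ → Set
EventuallyWithin s ε =
  ∃[ N ] (∀ m n → N ℕ.≤ m → N ℕ.≤ n → ℚ.∣ s m ℚ.- s n ∣ ℚ.< ε)

IsCauchy : Seq → Set
IsCauchy s = ∀ ε → 0ℚ ℚ.< ε → EventuallyWithin s ε

record ℝ : Set where
  constructor mkℝ
  field
    seq    : Seq
    cauchy : IsCauchy seq

open ℝ public

module Estimates where
  open import Data.Rational using (_+_; _*_; _-_; -_; ∣_∣; _≤_; _<_; 1/_; Positive; NonZero)
  open +-*-Solver

  half : ∀ ε → ½ * ε + ½ * ε ≡ ε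
  half ε = trans (sym (ℚ.*-distribʳ-+ ε ½ ½)) (ℚ.*-identityˡ ε)

  half>0 : ∀ {ε} → 0ℚ < ε → 0ℚ < ½ * ε
  half>0 = ℚ.*-monoʳ-<-pos ½

  flip-- : ∀ p q → - (p - q) ≡ q - p
  flip-- = solve 2 (λ a b → :- (a :- b) := b :- a) refl

  telescope : ∀ p q r → (p - q) + (q - r) ≡ p - r
  telescope = solve 3 (λ a b c → (a :- b) :+ (b :- c) := a :- c) refl

  cancel : ∀ p q → (p - q) + q ≡ p
  cancel = solve 2 (λ a b → (a :- b) :+ b := a) refl

  cancel′ : ∀ p q → (p + q) - q ≡ p
  cancel′ = solve 2 (λ a b → (a :+ b) :- b := a) refl

  interchange : ∀ p q r s → (p - r) + (q - s) ≡ (p + q) - (r + s)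
  interchange = solve 4 (λ a b c d →
    (a :- c) :+ (b :- d) := (a :+ b) :- (c :+ d)) refl

  neg-- : ∀ p q → q - p ≡ (- p) - (- q)
  neg-- = solve 2 (λ a b → b :- a := (:- a) :- (:- b)) refl

  product : ∀ p q r s → p * (q - s) + s * (p - r) ≡ p * q - r * s
  product = solve 4 (λ a b c d →
    a :* (b :- d) :+ d :* (a :- c) := a :* b :- c :* d) refl

  abs-self : ∀ {ε} p → 0ℚ < ε → ∣ p - p ∣ < ε
  abs-self {ε} p = subst (_< ε) (cong ∣_∣ (sym (ℚ.+-inverseʳ p)))

  abs-sym : ∀ p q → ∣ p - q ∣ ≡ ∣ q - p ∣
  abs-sym p q = trans (sym (ℚ.∣-p∣≡∣p∣ (p - q))) (cong ∣_∣ (flip-- p q))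

  abs-+ : ∀ p q {r} → p + q ≡ r → ∣ r ∣ ≤ ∣ p ∣ + ∣ q ∣
  abs-+ p q e = subst (λ z → ∣ z ∣ ≤ ∣ p ∣ + ∣ q ∣) e (ℚ.∣p+q∣≤∣p∣+∣q∣ p q)

  split : ∀ p q r → ∣ p - r ∣ ≤ ∣ p - q ∣ + ∣ q - r ∣
  split p q r = abs-+ (p - q) (q - r) (telescope p q r)

  abs-∸ : ∀ p q → ∣ p ∣ - ∣ q ∣ ≤ ∣ p - q ∣
  abs-∸ p q = subst (∣ p ∣ - ∣ q ∣ ≤_) (cancel′ ∣ p - q ∣ ∣ q ∣)
    (ℚ.+-monoˡ-≤ (- ∣ q ∣) (abs-+ (p - q) q (cancel p q)))

  abs-contract : ∀ p q → ∣ ∣ p ∣ - ∣ q ∣ ∣ ≤ ∣ p - q ∣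
  abs-contract p q with ℚ.∣p∣≡p∨∣p∣≡-p (∣ p ∣ - ∣ q ∣)
  ... | inj₁ e = subst (_≤ ∣ p - q ∣) (sym e) (abs-∸ p q)
  ... | inj₂ e = subst₂ _≤_
    (sym (trans e (flip-- ∣ p ∣ ∣ q ∣))) (abs-sym q p) (abs-∸ q p)

  <-halves : ∀ {p q ε} → p < ½ * ε → q < ½ * ε → p + q < ε
  <-halves {p} {q} {ε} f g = subst (p + q <_) (half ε) (ℚ.+-mono-< f g)

  EventuallyBounded : Seq → ℚ → Set
  EventuallyBounded s B = ∃[ N ] (∀ n → N ℕ.≤ n → ∣ s n ∣ ≤ B)

  bound : ∀ s → IsCauchy s → ∃[ B ] (0ℚ < B × EventuallyBounded s B)
  bound s c =
    let (N , h) = c 1ℚ (ℚ.positive⁻¹ 1ℚ)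
    in 1ℚ + ∣ s N ∣
     , ℚ.+-mono-<-≤ (ℚ.positive⁻¹ 1ℚ) (ℚ.0≤∣p∣ (s N))
     , N , λ n N≤n → ℚ.≤-trans (abs-+ (s n - s N) (s N) (cancel (s n) (s N)))
                       (ℚ.+-monoˡ-≤ ∣ s N ∣ (ℚ.<⇒≤ (h n N N≤n ℕ.≤-refl)))

  scale : ∀ A B ε → 0ℚ < A → 0ℚ < B → 0ℚ < ε →
          ∃[ δ ] (0ℚ < δ × A * δ + B * δ ≡ ε)
  scale A B ε A>0 B>0 ε>0 = 1/ (A + B) * ε , δ>0 , total
    where
    A+B-pos : Positive (A + B)
    A+B-pos = ℚ.positive (ℚ.+-mono-< A>0 B>0)

    instance
      A+B-nonZero : NonZero (A + B)
      A+B-nonZero = ℚ.pos⇒nonZero (A + B) {{A+B-pos}}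

    δ>0 : 0ℚ < 1/ (A + B) * ε
    δ>0 = subst (_< 1/ (A + B) * ε) (ℚ.*-zeroʳ (1/ (A + B)))
      (ℚ.*-monoʳ-<-pos (1/ (A + B)) {{ℚ.1/pos⇒pos (A + B) {{A+B-pos}}}} ε>0)

    total : A * (1/ (A + B) * ε) + B * (1/ (A + B) * ε) ≡ ε
    total = trans (sym (ℚ.*-distribʳ-+ (1/ (A + B) * ε) A B))
      (trans (sym (ℚ.*-assoc (A + B) (1/ (A + B)) ε))
        (trans (cong (_* ε) (ℚ.*-inverseʳ (A + B))) (ℚ.*-identityˡ ε)))

  abs-*-< : ∀ {C δ} p q → 0ℚ < C → ∣ p ∣ ≤ C → ∣ q ∣ < δ → ∣ p * q ∣ < C * δ
  abs-*-< {C} {δ} p q C>0 p≤C q<δ =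
    subst (_< C * δ) (sym (ℚ.∣p*q∣≡∣p∣*∣q∣ p q))
      (ℚ.≤-<-trans (ℚ.*-monoʳ-≤-nonNeg ∣ q ∣ {{ℚ.∣-∣-nonNeg q}} p≤C)
                   (ℚ.*-monoʳ-<-pos C {{ℚ.positive C>0}} q<δ))

  abs-product : ∀ {A B δ ε} p q r s → 0ℚ < A → 0ℚ < B → A * δ + B * δ ≡ ε →
    ∣ p ∣ ≤ A → ∣ s ∣ ≤ B → ∣ q - s ∣ < δ → ∣ p - r ∣ < δ →
    ∣ p * q - r * s ∣ < ε
  abs-product p q r s A>0 B>0 total p≤A s≤B q-s<δ p-r<δ = ℚ.≤-<-trans
    (abs-+ (p * (q - s)) (s * (p - r)) (product p q r s))
    (subst (∣ p * (q - s) ∣ + ∣ s * (p - r) ∣ <_) total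
      (ℚ.+-mono-< (abs-*-< p (q - s) A>0 p≤A q-s<δ)
                  (abs-*-< s (p - r) B>0 s≤B p-r<δ)))

  within-* : ∀ {s t A B δ ε} → 0ℚ < A → 0ℚ < B → A * δ + B * δ ≡ ε →
    EventuallyBounded s A → EventuallyBounded t B →
    EventuallyWithin s δ → EventuallyWithin t δ →
    EventuallyWithin (λ n → s n * t n) ε
  within-* {s} {t} A>0 B>0 total (K , f) (L , g) (M , h) (N , k) =
    (K ℕ.⊔ L) ℕ.⊔ (M ℕ.⊔ N) , λ m n p q →
    abs-product (s m) (t m) (s n) (t n) A>0 B>0 total
      (f m (ℕ.m⊔n≤o⇒m≤o K L (l p))) (g n (ℕ.m⊔n≤o⇒n≤o K L (l q)))
      (k m n (ℕ.m⊔n≤o⇒n≤o M N (r p)) (ℕ.m⊔n≤o⇒n≤o M N (r q)))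
      (h m n (ℕ.m⊔n≤o⇒m≤o M N (r p)) (ℕ.m⊔n≤o⇒m≤o M N (r q)))
    where
    l : ∀ {o} → (K ℕ.⊔ L) ℕ.⊔ (M ℕ.⊔ N) ℕ.≤ o → K ℕ.⊔ L ℕ.≤ o
    l = ℕ.m⊔n≤o⇒m≤o (K ℕ.⊔ L) (M ℕ.⊔ N)
    r : ∀ {o} → (K ℕ.⊔ L) ℕ.⊔ (M ℕ.⊔ N) ℕ.≤ o → M ℕ.⊔ N ℕ.≤ o
    r = ℕ.m⊔n≤o⇒n≤o (K ℕ.⊔ L) (M ℕ.⊔ N)

  -- Abstract only so that checking never unfolds these proofs.
  abstract
    const-cauchy : ∀ q → IsCauchy (λ _ → q)
    const-cauchy q ε ε>0 = 0 , λ _ _ _ _ → abs-self q ε>0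

    +-cauchy : ∀ s t → IsCauchy s → IsCauchy t → IsCauchy (λ n → s n + t n)
    +-cauchy s t c d ε ε>0 =
      let (M , g) = c (½ * ε) (half>0 ε>0)
          (N , h) = d (½ * ε) (half>0 ε>0)
      in M ℕ.⊔ N , λ m n p q → ℚ.≤-<-trans
           (abs-+ (s m - s n) (t m - t n) (interchange (s m) (t m) (s n) (t n)))
           (<-halves (g m n (ℕ.m⊔n≤o⇒m≤o M N p) (ℕ.m⊔n≤o⇒m≤o M N q))
                     (h m n (ℕ.m⊔n≤o⇒n≤o M N p) (ℕ.m⊔n≤o⇒n≤o M N q)))

    neg-cauchy : ∀ s → IsCauchy s → IsCauchy (λ n → - s n)
    neg-cauchy s c ε ε>0 =
      let (N , h) = c ε ε>0
      in N , λ m n p q →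
           subst (λ z → ∣ z ∣ < ε) (neg-- (s m) (s n)) (h n m q p)

    abs-cauchy : ∀ s → IsCauchy s → IsCauchy (λ n → ∣ s n ∣)
    abs-cauchy s c ε ε>0 =
      let (N , h) = c ε ε>0
      in N , λ m n p q → ℚ.≤-<-trans (abs-contract (s m) (s n)) (h m n p q)

    *-cauchy : ∀ s t → IsCauchy s → IsCauchy t → IsCauchy (λ n → s n * t n)
    *-cauchy s t c d ε ε>0 = combine (bound s c) (bound t d)
      where
      combine : ∃[ A ] (0ℚ < A × EventuallyBounded s A) →
                ∃[ B ] (0ℚ < B × EventuallyBounded t B) →
                EventuallyWithin (λ n → s n * t n) ε
      combine (A , A>0 , f) (B , B>0 , g) = rescale (scale A B ε A>0 B>0 ε>0)
        where
        rescale : ∃[ δ ] (0ℚ < δ × A * δ + B * δ ≡ ε) →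
                  EventuallyWithin (λ n → s n * t n) ε
        rescale (δ , δ>0 , total) =
          within-* {s} {t} A>0 B>0 total f g (c δ δ>0) (d δ δ>0)

infix 4 _≈_ _<_

record _≈_ (x y : ℝ) : Set where
  constructor mk≈
  field
    close : ∀ ε → 0ℚ ℚ.< ε → ∃[ N ] (∀ n → N ℕ.≤ n →
            ℚ.∣ seq x n ℚ.- seq y n ∣ ℚ.< ε)

record _<_ (x y : ℝ) : Set where
  constructor mk<
  field
    gap   : ℚ
    gap>0 : 0ℚ ℚ.< gap
    below : ∃[ N ] (∀ n → N ℕ.≤ n → seq x n ℚ.+ gap ℚ.≤ seq y n)

≈-isEquivalence : IsEquivalence _≈_
≈-isEquivalence = record
  { refl  = λ {x} → mk≈ λ ε ε>0 → 0 , λ n _ → abs-self (seq x n) ε>0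
  ; sym   = λ {x} {y} p → mk≈ λ ε ε>0 →
      let (N , h) = _≈_.close p ε ε>0
      in N , λ n N≤n → subst (ℚ._< ε) (abs-sym (seq x n) (seq y n)) (h n N≤n)
  ; trans = λ {x} {y} {z} p q → mk≈ λ ε ε>0 →
      let (M , g) = _≈_.close p (½ ℚ.* ε) (half>0 ε>0)
          (N , h) = _≈_.close q (½ ℚ.* ε) (half>0 ε>0)
      in M ℕ.⊔ N , λ n le → ℚ.≤-<-trans
           (split (seq x n) (seq y n) (seq z n))
           (<-halves (g n (ℕ.m⊔n≤o⇒m≤o M N le)) (h n (ℕ.m⊔n≤o⇒n≤o M N le)))
  }
  where open Estimates

ℝ-setoid : Setoid 0ℓ 0ℓ
ℝ-setoid = record { isEquivalence = ≈-isEquivalence }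

fromℚ : ℚ → ℝ
fromℚ q = mkℝ (λ _ → q) (Estimates.const-cauchy q)

0ℝ : ℝ
0ℝ = fromℚ 0ℚ

infixl 6 _+_ _-_
infixl 7 _*_
infix  8 -_

_+_ : ℝ → ℝ → ℝ
x + y = mkℝ (λ n → seq x n ℚ.+ seq y n)
            (Estimates.+-cauchy (seq x) (seq y) (cauchy x) (cauchy y))

-_ : ℝ → ℝ
- x = mkℝ (λ n → ℚ.- seq x n) (Estimates.neg-cauchy (seq x) (cauchy x))

_-_ : ℝ → ℝ → ℝ
x - y = x + - y

_*_ : ℝ → ℝ → ℝ
x * y = mkℝ (λ n → seq x n ℚ.* seq y n)
            (Estimates.*-cauchy (seq x) (seq y) (cauchy x) (cauchy y))

∣_∣ : ℝ → ℝ
∣ x ∣ = mkℝ (λ n → ℚ.∣ seq x n ∣) (Estimates.abs-cauchy (seq x) (cauchy x))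

ℝ² : Set
ℝ² = ℝ × ℝ

infix 4 _≈²_
infixl 6 _-²_

_≈²_ : ℝ² → ℝ² → Set
(x , y) ≈² (x′ , y′) = x ≈ x′ × y ≈ y′

_-²_ : ℝ² → ℝ² → ℝ²
(x , y) -² (x′ , y′) = (x - x′) , (y - y′)

‖_‖₁ : ℝ² → ℝ
‖ x , y ‖₁ = ∣ x ∣ + ∣ y ∣

dist : ℝ² → ℝ² → ℝ
dist p q = ‖ p -² q ‖₁

-- The line a x + b y = c with (a , b) ≠ (0 , 0).
record Line : Set where
  field
    a b c       : ℝ
    nonconstant : ¬ (a ≈ 0ℝ × b ≈ 0ℝ)

OnLine : Line → ℝ² → Set
OnLine ℓ (x , y) = a * x + b * y ≈ c
  where open Line ℓ

record Circle : Set where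
  field
    centre : ℝ²
    radius : ℝ
    radius>0 : 0ℝ < radius

OnCircle : Circle → ℝ² → Set
OnCircle C q = dist q centre ≈ radius
  where open Circle C

-- Below, an n-point subset of the plane is an enumeration Fin n → ℝ² which
-- is injective up to _≈²_.

Distinct : ∀ {n} → (Fin n → ℝ²) → Set
Distinct = Injective _≡_ _≈²_

-- {1,…,n} is represented by Fin n via k ↦ suc (toℕ k); the shift by one
-- cancels in the differences.

LineLike : ∀ {n} → (Fin n → ℝ²) → Set
LineLike {n} S = ∃[ φ ] ∀ a b c d →
  dist (S a) (S b) ≈ dist (S c) (S d) ⇔
  ℕ.∣ pos φ a - pos φ b ∣ ≡ ℕ.∣ pos φ c - pos φ d ∣
  where
  pos : Permutation′ n → Fin n → ℕ
  pos φ i = toℕ (φ ⟨$⟩ʳ i)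

-- A choice of k points of S is an injection of indices Fin k → Fin n.

record StrongGeneralPosition {n} (S : Fin n → ℝ²) : Set where
  field
    noThreeOnLine : (s : Fin 3 → Fin n) → Injective _≡_ _≡_ s →
      ¬ (∃[ ℓ ] ∀ i → OnLine ℓ (S (s i)))
    noFourOnCircle : (s : Fin 4 → Fin n) → Injective _≡_ _≡_ s →
      ¬ (∃[ C ] ∀ i → OnCircle C (S (s i)))
    noFourLineLike : (s : Fin 4 → Fin n) → Injective _≡_ _≡_ s →
      ¬ LineLike (S ∘ s)

module _ (A : Setoid 0ℓ 0ℓ) where
  open Setoid A using (Carrier) renaming (_≈_ to _∼_)

  -- P has exactly k elements, counted up to the setoid equality.
  HasExactly : ℕ → (Carrier → Set) → Set
  HasExactly k P = ∃[ e ]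
    (Injective {A = Fin k} _≡_ _∼_ e × (∀ x → P x ⇔ (∃[ i ] e i ∼ x)))

IsDistance : ∀ {n} → (Fin n → ℝ²) → ℝ → Set
IsDistance S δ = ∃[ i ] ∃[ j ] (i ≢ j × dist (S i) (S j) ≈ δ)

-- Unordered pairs of distinct points are index pairs (i , j) with i < j.

HasMultiplicity : ∀ {n} → (Fin n → ℝ²) → ℝ → ℕ → Set
HasMultiplicity {n} S δ m =
  HasExactly (setoid (Fin n × Fin n)) m
    λ (i , j) → i Fin.< j × dist (S i) (S j) ≈ δ

record StrongCrescent (n : ℕ) (S : Fin n → ℝ²) : Set where
  field
    distinct       : Distinct S
    generalPos     : StrongGeneralPosition S
    distances      : HasExactly ℝ-setoid (n ∸ 1) (IsDistance S)
    multiplicities : ∀ i → 1 ℕ.≤ i → i ℕ.≤ n ∸ 1 →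
      ∃[ δ ] (IsDistance S δ × HasMultiplicity S δ i)

{-# OPTIONS --safe #-}

-- Every point set used has integer coordinates, so all hypotheses reduce to
-- decidable statements over ℤ.  Circles: σ·(p − c) ≤ dist p c for each of
-- the four directions σ = (±1 , ±1), with equality for one of them.  If i and
-- k are among the points of a circle with active directions σ and τ, then no
-- point exceeds i along σ or k along τ, and when τ = −σ the width σ·(i − k)
-- is the diameter, hence at least the width of the point set in any direction.
module Submission where

open import Defs hiding (_<_; _+_; -_; _-_; _*_; ∣_∣)
import Data.Rational.Properties as ℚ
open import Algebra.Properties.Group ℚ.+-0-group using (x∙y⁻¹≈ε⇒x≈y; ⁻¹-involutive)
open import Data.Empty using (⊥; ⊥-elim)
open import Data.Fin as Fin using (Fin; zero; suc; toℕ; fromℕ<)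
open import Data.Fin.Patterns using (0F; 1F; 2F; 3F)
open import Data.Fin.Permutation using (_⟨$⟩ʳ_; _⟨$⟩ˡ_; inverseʳ)
import Data.Fin.Properties as Fin
open import Data.Integer as ℤ using (ℤ; +_)
import Data.Integer.Properties as ℤ
open import Data.Integer.Tactic.RingSolver using (solve-∀)
open import Data.List as List
  using (List; []; _∷_; length; filter; cartesianProduct; allFin)
open import Data.List.Membership.Propositional using (_∈_)
open import Data.List.Membership.Propositional.Properties
  using (∈-lookup; ∈-filter⁺; ∈-filter⁻; ∈-cartesianProduct⁺; ∈-allFin)
import Data.List.Relation.Unary.All as All
open import Data.List.Relation.Unary.AllPairs using (_∷_)
open import Data.List.Relation.Unary.Any using (here; index)
open import Data.List.Relation.Unary.Any.Properties using (lookup-index)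
open import Data.List.Relation.Unary.Unique.DecPropositional using (unique?)
open import Data.List.Relation.Unary.Unique.Propositional using (Unique)
open import Data.List.Relation.Unary.Unique.Propositional.Properties
  using (tabulate⁺; cartesianProduct⁺; allFin⁺; filter⁺)
open import Data.Nat as ℕ using (ℕ; zero; suc; _≤_; _∸_; s≤s)
import Data.Nat.Properties as ℕ
open import Data.Product using (∃; ∃-syntax; _×_; _,_; proj₁; proj₂)
open import Data.Product.Properties using (≡-dec)
open import Data.Rational as ℚ using (ℚ; 0ℚ; 1ℚ; ½; _+_; -_; _-_; _*_; ∣_∣)
open import Data.Rational.Solver using (module +-*-Solver)
import Data.Rational.Unnormalised as ℚᵘ
import Data.Rational.Unnormalised.Properties as ℚᵘ
open import Data.Sign as Sign using (Sign)
open import Data.Sum using (_⊎_; inj₁; inj₂; [_,_]′)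
open import Data.Vec as Vec using (Vec; []; _∷_)
open import Function.Base using (_∘_; _$_)
open import Function.Bundles using (_⇔_; mk⇔; Equivalence)
open import Function.Definitions using (Injective)
open import Relation.Binary.PropositionalEquality hiding ([_])
open import Relation.Binary.Structures using (IsEquivalence)
open import Relation.Nullary using (¬_; Dec; _×-dec_; _⊎-dec_; _→-dec_; ¬?)
open import Relation.Nullary.Decidable using (True; map′; toWitness; decidable-stable)
open import Relation.Unary using (Decidable)

-- Embedding of ℤ in ℚ

-- Abstract only so that checking never unfolds rational arithmetic.
abstract
  ι : ℤ → ℚ
  ι z = z ℚ./ 1

  -- `_/_` normalises by a gcd, so the laws below are checked on unnormalised fractions. The 0 in
  -- `mkℚᵘ z 0` encodes the denominator 1 by its predecessor.
  toℚᵘ-ι : ∀ z → ℚ.toℚᵘ (ι z) ℚᵘ.≃ ℚᵘ.mkℚᵘ z 0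
  toℚᵘ-ι z = ℚ.toℚᵘ-fromℚᵘ (ℚᵘ.mkℚᵘ z 0)

  ι-+ : ∀ x y → ι (x ℤ.+ y) ≡ ι x + ι y
  ι-+ x y = ℚ.toℚᵘ-injective $ begin
    ℚ.toℚᵘ (ι (x ℤ.+ y))             ≈⟨ toℚᵘ-ι (x ℤ.+ y) ⟩
    ℚᵘ.mkℚᵘ (x ℤ.+ y) 0              ≈⟨ ℚᵘ.*≡* (clear x y) ⟩
    ℚᵘ.mkℚᵘ x 0 ℚᵘ.+ ℚᵘ.mkℚᵘ y 0     ≈⟨ ℚᵘ.+-cong (toℚᵘ-ι x) (toℚᵘ-ι y) ⟨
    ℚ.toℚᵘ (ι x) ℚᵘ.+ ℚ.toℚᵘ (ι y)   ≈⟨ ℚ.toℚᵘ-homo-+ (ι x) (ι y) ⟨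
    ℚ.toℚᵘ (ι x + ι y)               ∎
    where
    open ℚᵘ.≃-Reasoning
    clear : ∀ x y → (x ℤ.+ y) ℤ.* + 1 ≡ (x ℤ.* + 1 ℤ.+ y ℤ.* + 1) ℤ.* + 1
    clear = solve-∀

  ι-* : ∀ x y → ι (x ℤ.* y) ≡ ι x * ι y
  ι-* x y = ℚ.toℚᵘ-injective $ begin
    ℚ.toℚᵘ (ι (x ℤ.* y))             ≈⟨ toℚᵘ-ι (x ℤ.* y) ⟩
    ℚᵘ.mkℚᵘ x 0 ℚᵘ.* ℚᵘ.mkℚᵘ y 0     ≈⟨ ℚᵘ.*-cong (toℚᵘ-ι x) (toℚᵘ-ι y) ⟨
    ℚ.toℚᵘ (ι x) ℚᵘ.* ℚ.toℚᵘ (ι y)   ≈⟨ ℚ.toℚᵘ-homo-* (ι x) (ι y) ⟨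
    ℚ.toℚᵘ (ι x * ι y)               ∎
    where open ℚᵘ.≃-Reasoning

  ι-neg : ∀ x → ι (ℤ.- x) ≡ - ι x
  ι-neg x = ℚ.toℚᵘ-injective $ begin
    ℚ.toℚᵘ (ι (ℤ.- x))      ≈⟨ toℚᵘ-ι (ℤ.- x) ⟩
    ℚᵘ.- ℚᵘ.mkℚᵘ x 0        ≈⟨ ℚᵘ.-‿cong (toℚᵘ-ι x) ⟨
    ℚᵘ.- ℚ.toℚᵘ (ι x)       ≈⟨ ℚ.toℚᵘ-homo‿- (ι x) ⟨
    ℚ.toℚᵘ (- ι x)          ∎
    where open ℚᵘ.≃-Reasoning

  ι-abs : ∀ x → ι (+ ℤ.∣ x ∣) ≡ ∣ ι x ∣
  ι-abs x = ℚ.toℚᵘ-injective $ begin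
    ℚ.toℚᵘ (ι (+ ℤ.∣ x ∣))      ≈⟨ toℚᵘ-ι (+ ℤ.∣ x ∣) ⟩
    ℚᵘ.∣ ℚᵘ.mkℚᵘ x 0 ∣          ≈⟨ ℚᵘ.∣-∣-cong (toℚᵘ-ι x) ⟨
    ℚᵘ.∣ ℚ.toℚᵘ (ι x) ∣         ≈⟨ ℚ.toℚᵘ-homo-∣-∣ (ι x) ⟨
    ℚ.toℚᵘ ∣ ι x ∣              ∎
    where open ℚᵘ.≃-Reasoning

  ι-minus : ∀ x y → ι (x ℤ.- y) ≡ ι x - ι y
  ι-minus x y = trans (ι-+ x (ℤ.- y)) (cong (_+_ (ι x)) (ι-neg y))

  ι-injective : Injective _≡_ _≡_ ι
  ι-injective {x} {y} e with ℚ.fromℚᵘ-injective {ℚᵘ.mkℚᵘ x 0} {ℚᵘ.mkℚᵘ y 0} e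
  ... | ℚᵘ.*≡* x*1≡y*1 = ℤ.*-cancelʳ-≡ x y (+ 1) x*1≡y*1

  ι-mono-≤ : ∀ {x y} → x ℤ.≤ y → ι x ℚ.≤ ι y
  ι-mono-≤ {x} {y} x≤y = ℚ.toℚᵘ-cancel-≤ $ begin
    ℚ.toℚᵘ (ι x)     ≃⟨ toℚᵘ-ι x ⟩
    ℚᵘ.mkℚᵘ x 0      ≤⟨ ℚᵘ.*≤* (ℤ.*-monoʳ-≤-nonNeg (+ 1) x≤y) ⟩
    ℚᵘ.mkℚᵘ y 0      ≃⟨ toℚᵘ-ι y ⟨
    ℚ.toℚᵘ (ι y)     ∎
    where open ℚᵘ.≤-Reasoning

  -- Integrality widens a strict inequality to a gap of 1, which survives the passage from reals to
  -- rational approximations.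
  ι-gap : ∀ {x y} → x ℤ.< y → ι x + 1ℚ ℚ.≤ ι y
  ι-gap {x} {y} x<y = subst (ℚ._≤ ι y)
    (trans (ι-+ (+ 1) x) (ℚ.+-comm (ι (+ 1)) (ι x))) (ι-mono-≤ (ℤ.i<j⇒suc[i]≤j x<y))

  -- Computes only inside the abstract block; outside it `ι` does not unfold.
  ι-0 : ι (+ 0) ≡ 0ℚ
  ι-0 = refl

-- Constant and null sequences

-- If `q` and `r` differed, `∣ q - r ∣` would itself be a tolerance that the constant sequences
-- violate. Decidable equality on ℚ removes the double negation.
fromℚ-injective : ∀ {q r} → fromℚ q ≈ fromℚ r → q ≡ r
fromℚ-injective {q} {r} e = decidable-stable (q ℚ.≟ r) λ q≢r →
  let 0<∣q-r∣ = ℚ.≰⇒> λ ∣q-r∣≤0 → q≢r (x∙y⁻¹≈ε⇒x≈y q r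
        (ℚ.∣p∣≡0⇒p≡0 (q - r) (ℚ.≤-antisym ∣q-r∣≤0 (ℚ.0≤∣p∣ (q - r)))))
      (N , h) = _≈_.close e ∣ q - r ∣ 0<∣q-r∣
  in ℚ.<-irrefl refl (h N ℕ.≤-refl)

-- `x ≈ y` wraps `Null` of the termwise difference, so equations between reals can be combined as
-- null sequences.
Null : Seq → Set
Null s = ∀ ε → 0ℚ ℚ.< ε → ∃[ N ] (∀ n → N ℕ.≤ n → ∣ s n ∣ ℚ.< ε)

Null-linear : ∀ {s t} p q → Null s → Null t → Null (λ n → p * s n + q * t n)
Null-linear {s} {t} p q s→0 t→0 ε ε>0 =
  let (δ , δ>0 , total) = scale (bnd p) (bnd q) ε (bnd>0 p) (bnd>0 q) ε>0
      (M , g) = s→0 δ δ>0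
      (N , h) = t→0 δ δ>0
  in M ℕ.⊔ N , λ n M⊔N≤n → ℚ.≤-<-trans (ℚ.∣p+q∣≤∣p∣+∣q∣ (p * s n) (q * t n))
       (subst (∣ p * s n ∣ + ∣ q * t n ∣ ℚ.<_) total (ℚ.+-mono-<
         (abs-*-< p (s n) (bnd>0 p) (≤bnd p) (g n (ℕ.m⊔n≤o⇒m≤o M N M⊔N≤n)))
         (abs-*-< q (t n) (bnd>0 q) (≤bnd q) (h n (ℕ.m⊔n≤o⇒n≤o M N M⊔N≤n)))))
  where
  open Estimates
  -- The added `1ℚ` keeps the bound positive for a zero coefficient, as `scale` requires.
  bnd : ℚ → ℚ
  bnd r = 1ℚ + ∣ r ∣
  bnd>0 : ∀ r → 0ℚ ℚ.< bnd r
  bnd>0 r = ℚ.+-mono-<-≤ (ℚ.positive⁻¹ 1ℚ) (ℚ.0≤∣p∣ r)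
  ≤bnd : ∀ r → ∣ r ∣ ℚ.≤ bnd r
  ≤bnd r = subst (ℚ._≤ bnd r) (ℚ.+-identityˡ ∣ r ∣)
    (ℚ.+-monoˡ-≤ ∣ r ∣ (ℚ.<⇒≤ (ℚ.positive⁻¹ 1ℚ)))

Null-resp : ∀ {s t} → (∀ n → s n ≡ t n) → Null s → Null t
Null-resp s≡t s→0 ε ε>0 =
  let (N , h) = s→0 ε ε>0
  in N , λ n N≤n → subst (λ r → ∣ r ∣ ℚ.< ε) (s≡t n) (h n N≤n)

-- Integer points

ℤ² : Set
ℤ² = ℤ × ℤ

embed : ℤ² → ℝ²
embed (x , y) = fromℚ (ι x) , fromℚ (ι y)

δ : ℤ² → ℤ² → ℕ
δ (x , y) (x′ , y′) = ℤ.∣ x ℤ.- x′ ∣ ℕ.+ ℤ.∣ y ℤ.- y′ ∣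

dist-embed : ∀ p q → dist (embed p) (embed q) ≈ fromℚ (ι (+ δ p q))
dist-embed p@(x , y) q@(x′ , y′) = mk≈ λ ε ε>0 → 0 , λ _ _ →
  subst (λ r → ∣ ∣ ι x - ι x′ ∣ + ∣ ι y - ι y′ ∣ - r ∣ ℚ.< ε) (sym ι-δ)
    (Estimates.abs-self (∣ ι x - ι x′ ∣ + ∣ ι y - ι y′ ∣) ε>0)
  where
  ι-abs-minus : ∀ a b → ι (+ ℤ.∣ a ℤ.- b ∣) ≡ ∣ ι a - ι b ∣
  ι-abs-minus a b = trans (ι-abs (a ℤ.- b)) (cong ∣_∣ (ι-minus a b))
  ι-δ : ι (+ δ p q) ≡ ∣ ι x - ι x′ ∣ + ∣ ι y - ι y′ ∣
  ι-δ = trans (ι-+ (+ ℤ.∣ x ℤ.- x′ ∣) (+ ℤ.∣ y ℤ.- y′ ∣))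
    (cong₂ _+_ (ι-abs-minus x x′) (ι-abs-minus y y′))

module ≈ = IsEquivalence ≈-isEquivalence

fromℕ-injective : ∀ {k l} → fromℚ (ι (+ k)) ≈ fromℚ (ι (+ l)) → k ≡ l
fromℕ-injective = ℤ.+-injective ∘ ι-injective ∘ fromℚ-injective

dist≈⇒δ≡ : ∀ p q {k} → dist (embed p) (embed q) ≈ fromℚ (ι (+ k)) → δ p q ≡ k
dist≈⇒δ≡ p q e = fromℕ-injective (≈.trans (≈.sym (dist-embed p q)) e)

δ≡⇒dist≈ : ∀ p q {k} → δ p q ≡ k → dist (embed p) (embed q) ≈ fromℚ (ι (+ k))
δ≡⇒dist≈ p q refl = dist-embed p q

dist≈dist⇒δ≡δ : ∀ p q r s →
  dist (embed p) (embed q) ≈ dist (embed r) (embed s) → δ p q ≡ δ r s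
dist≈dist⇒δ≡δ p q r s e = dist≈⇒δ≡ p q (≈.trans e (dist-embed r s))

embed-injective : Injective _≡_ _≈²_ embed
embed-injective (x≈x′ , y≈y′) =
  cong₂ _,_ (ι-injective (fromℚ-injective x≈x′)) (ι-injective (fromℚ-injective y≈y′))

-- Lines

-- Twice the signed area of the triangle.
det : ℤ² → ℤ² → ℤ² → ℤ
det (x₁ , y₁) (x₂ , y₂) (x₃ , y₃) =
  x₁ ℤ.* (y₂ ℤ.- y₃) ℤ.+ x₂ ℤ.* (y₃ ℤ.- y₁) ℤ.+ x₃ ℤ.* (y₁ ℤ.- y₂)

ι-det : ∀ ((x₁ , y₁) (x₂ , y₂) (x₃ , y₃) : ℤ²) →
  ι (det (x₁ , y₁) (x₂ , y₂) (x₃ , y₃)) ≡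
  ι x₁ * (ι y₂ - ι y₃) + ι x₂ * (ι y₃ - ι y₁) + ι x₃ * (ι y₁ - ι y₂)
ι-det (x₁ , y₁) (x₂ , y₂) (x₃ , y₃) = trans
  (ι-+ (x₁ ℤ.* (y₂ ℤ.- y₃) ℤ.+ x₂ ℤ.* (y₃ ℤ.- y₁)) (x₃ ℤ.* (y₁ ℤ.- y₂)))
  (cong₂ _+_
    (trans (ι-+ (x₁ ℤ.* (y₂ ℤ.- y₃)) (x₂ ℤ.* (y₃ ℤ.- y₁)))
      (cong₂ _+_ (term x₁ y₂ y₃) (term x₂ y₃ y₁)))
    (term x₃ y₁ y₂))
  where
  term : ∀ x y z → ι (x ℤ.* (y ℤ.- z)) ≡ ι x * (ι y - ι z)
  term x y z = trans (ι-* x (y ℤ.- z)) (cong (ι x *_) (ι-minus y z))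

-- Cramer's rule for the coefficients of a line through three points.
det≢0⇒noncollinear : ∀ p q r → det p q r ≢ + 0 → (ℓ : Line) →
  OnLine ℓ (embed p) → OnLine ℓ (embed q) → OnLine ℓ (embed r) → ⊥
det≢0⇒noncollinear p@(x₁ , y₁) q@(x₂ , y₂) r@(x₃ , y₃) det≢0 ℓ
  (mk≈ on₁) (mk≈ on₂) (mk≈ on₃) = nonconstant
    -- The weights are cofactors: the first three cancel `b` and `c` and leave the determinant times
    -- `a`, the other three cancel `a` and `c` and leave it times `b`. The factor `k` then divides
    -- by the determinant.
    ( mk≈ (Null-resp eqᵃ (combination (Y₂ - Y₃) (Y₃ - Y₁) (Y₁ - Y₂)))
    , mk≈ (Null-resp eqᵇ (combination (X₃ - X₂) (X₁ - X₃) (X₂ - X₁))))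
  where
  open Line ℓ
  X₁ = ι x₁ ; X₂ = ι x₂ ; X₃ = ι x₃ ; Y₁ = ι y₁ ; Y₂ = ι y₂ ; Y₃ = ι y₃
  instance
    ιdet-nonZero : ℚ.NonZero (ι (det p q r))
    ιdet-nonZero = ℚ.≢-nonZero λ e → det≢0 (ι-injective (trans e (sym ι-0)))
  k : ℚ
  k = ℚ.1/ ι (det p q r)
  k-inverse : k * (X₁ * (Y₂ - Y₃) + X₂ * (Y₃ - Y₁) + X₃ * (Y₁ - Y₂)) ≡ 1ℚ
  k-inverse = trans (cong (k *_) (sym (ι-det p q r))) (ℚ.*-inverseˡ (ι (det p q r)))
  e : ℤ → ℤ → Seq
  e x y n = seq a n * ι x + seq b n * ι y - seq c n
  -- The `1ℚ` arises from nesting the two-term `Null-linear` to combine three residuals.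
  combination : ∀ u v w → Null λ n →
    (k * u) * e x₁ y₁ n + 1ℚ * ((k * v) * e x₂ y₂ n + (k * w) * e x₃ y₃ n)
  combination u v w = Null-linear (k * u) 1ℚ on₁ (Null-linear (k * v) (k * w) on₂ on₃)
  open +-*-Solver
  scale-by-1 : ∀ z {t} → t ≡ 1ℚ → t * z ≡ z - 0ℚ
  scale-by-1 z refl = trans (ℚ.*-identityˡ z) (sym (ℚ.+-identityʳ z))
  eqᵃ : ∀ n → (k * (Y₂ - Y₃)) * e x₁ y₁ n + 1ℚ *
    ((k * (Y₃ - Y₁)) * e x₂ y₂ n + (k * (Y₁ - Y₂)) * e x₃ y₃ n) ≡ seq a n - 0ℚ
  eqᵃ n = trans
    (solve 10 (λ k a b c x₁ x₂ x₃ y₁ y₂ y₃ →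
      (k :* (y₂ :- y₃)) :* (a :* x₁ :+ b :* y₁ :- c) :+ con 1ℚ :*
      ((k :* (y₃ :- y₁)) :* (a :* x₂ :+ b :* y₂ :- c)
        :+ (k :* (y₁ :- y₂)) :* (a :* x₃ :+ b :* y₃ :- c))
      := (k :* (x₁ :* (y₂ :- y₃) :+ x₂ :* (y₃ :- y₁) :+ x₃ :* (y₁ :- y₂))) :* a)
      refl k (seq a n) (seq b n) (seq c n) X₁ X₂ X₃ Y₁ Y₂ Y₃)
    (scale-by-1 (seq a n) k-inverse)
  eqᵇ : ∀ n → (k * (X₃ - X₂)) * e x₁ y₁ n + 1ℚ *
    ((k * (X₁ - X₃)) * e x₂ y₂ n + (k * (X₂ - X₁)) * e x₃ y₃ n) ≡ seq b n - 0ℚ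
  eqᵇ n = trans
    (solve 10 (λ k a b c x₁ x₂ x₃ y₁ y₂ y₃ →
      (k :* (x₃ :- x₂)) :* (a :* x₁ :+ b :* y₁ :- c) :+ con 1ℚ :*
      ((k :* (x₁ :- x₃)) :* (a :* x₂ :+ b :* y₂ :- c)
        :+ (k :* (x₂ :- x₁)) :* (a :* x₃ :+ b :* y₃ :- c))
      := (k :* (x₁ :* (y₂ :- y₃) :+ x₂ :* (y₃ :- y₁) :+ x₃ :* (y₁ :- y₂))) :* b)
      refl k (seq a n) (seq b n) (seq c n) X₁ X₂ X₃ Y₁ Y₂ Y₃)
    (scale-by-1 (seq b n) k-inverse)

-- Circles

signed : {A : Set} → (A → A) → Sign → A → A
signed neg Sign.+ x = x
signed neg Sign.- x = neg x

Direction : Set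
Direction = Sign × Sign

opp : Direction → Direction
opp (s , t) = Sign.opposite s , Sign.opposite t

⟨_∣_⟩ : Direction → ℤ² → ℤ
⟨ s , t ∣ x , y ⟩ = signed ℤ.-_ s x ℤ.+ signed ℤ.-_ t y

⟪_∣_⟫ : Direction → ℚ × ℚ → ℚ
⟪ s , t ∣ x , y ⟫ = signed -_ s x + signed -_ t y

ι-⟨⟩ : ∀ σ ((x , y) : ℤ²) → ι ⟨ σ ∣ x , y ⟩ ≡ ⟪ σ ∣ ι x , ι y ⟫
ι-⟨⟩ (s , t) (x , y) = trans (ι-+ (signed ℤ.-_ s x) (signed ℤ.-_ t y))
  (cong₂ _+_ (ι-signed s x) (ι-signed t y))
  where
  ι-signed : ∀ s x → ι (signed ℤ.-_ s x) ≡ signed -_ s (ι x)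
  ι-signed Sign.+ x = refl
  ι-signed Sign.- x = ι-neg x

⟪⟫-minus : ∀ σ x y a b → ⟪ σ ∣ x - a , y - b ⟫ ≡ ⟪ σ ∣ x , y ⟫ - ⟪ σ ∣ a , b ⟫
⟪⟫-minus (s , t) x y a b = trans (cong₂ _+_ (signed-minus s x a) (signed-minus t y b))
  (Estimates.interchange (signed -_ s x) (signed -_ t y) (signed -_ s a) (signed -_ t b))
  where
  signed-minus : ∀ s x a → signed -_ s (x - a) ≡ signed -_ s x - signed -_ s a
  signed-minus Sign.+ x a = refl
  signed-minus Sign.- x a = ℚ.neg-distrib-+ x (- a)

⟪⟫-opp : ∀ σ p → ⟪ opp σ ∣ p ⟫ ≡ - ⟪ σ ∣ p ⟫
⟪⟫-opp (s , t) (x , y) = trans (cong₂ _+_ (signed-opp s x) (signed-opp t y))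
  (sym (ℚ.neg-distrib-+ (signed -_ s x) (signed -_ t y)))
  where
  signed-opp : ∀ s x → signed -_ (Sign.opposite s) x ≡ - signed -_ s x
  signed-opp Sign.+ x = refl
  signed-opp Sign.- x = sym (⁻¹-involutive x)

p≤∣p∣ : ∀ p → p ℚ.≤ ∣ p ∣
p≤∣p∣ p = [ ℚ.≤-reflexive ∘ sym ∘ ℚ.0≤p⇒∣p∣≡p
          , (λ p≤0 → ℚ.≤-trans p≤0 (ℚ.0≤∣p∣ p)) ]′ (ℚ.≤-total 0ℚ p)

-- Together with `⟪⟫-attained` this presents the taxicab norm as the maximum of four linear
-- functionals.
⟪⟫-≤ : ∀ σ x y → ⟪ σ ∣ x , y ⟫ ℚ.≤ ∣ x ∣ + ∣ y ∣
⟪⟫-≤ (s , t) x y = ℚ.+-mono-≤ (signed-≤ s x) (signed-≤ t y)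
  where
  signed-≤ : ∀ s x → signed -_ s x ℚ.≤ ∣ x ∣
  signed-≤ Sign.+ x = p≤∣p∣ x
  signed-≤ Sign.- x = subst (- x ℚ.≤_) (ℚ.∣-p∣≡∣p∣ x) (p≤∣p∣ (- x))

⟪⟫-attained : ∀ x y → ∃[ σ ] ∣ x ∣ + ∣ y ∣ ≡ ⟪ σ ∣ x , y ⟫
⟪⟫-attained x y =
  let (s , ∣x∣≡) = signed-attained x
      (t , ∣y∣≡) = signed-attained y
  in (s , t) , cong₂ _+_ ∣x∣≡ ∣y∣≡
  where
  signed-attained : ∀ x → ∃[ s ] ∣ x ∣ ≡ signed -_ s x
  signed-attained x = [ (Sign.+ ,_) , (Sign.- ,_) ]′ (ℚ.∣p∣≡p∨∣p∣≡-p x)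

-- A finite criterion for lying on no common circle

module _ {m} (q : Fin m → ℤ²) where
  Exceeded : Direction → Fin m → Set
  Exceeded σ i = ∃[ j ] ⟨ σ ∣ q i ⟩ ℤ.< ⟨ σ ∣ q j ⟩

  -- Since `opp` negates the functional, the two sums are the widths `σ·(i − k)` and `ρ·(j − l)`.
  Narrow : Direction → Fin m → Fin m → Set
  Narrow σ i k = ∃[ ρ ] ∃[ j ] ∃[ l ]
    ⟨ σ ∣ q i ⟩ ℤ.+ ⟨ opp σ ∣ q k ⟩ ℤ.< ⟨ ρ ∣ q j ⟩ ℤ.+ ⟨ opp ρ ∣ q l ⟩

  -- `σ` and `τ` run over the candidates for the active directions of `i` and `k` as seen from an
  -- unknown centre. Every combination must be refuted.
  NonConcyclic : Set
  NonConcyclic = ∃[ i ] ∃[ k ] ∀ σ → Exceeded σ i ⊎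
    (∀ τ → Exceeded τ k ⊎ (τ ≡ opp σ × Narrow σ i k))

  module _ (a b : ℚ) where
    radius : Fin m → ℚ
    radius i = let (x , y) = q i in ∣ ι x - a ∣ + ∣ ι y - b ∣

    private
      κ : Direction → ℚ
      κ σ = ⟪ σ ∣ a , b ⟫

      ⟪⟫≡ : ∀ σ i → let (x , y) = q i in
        ⟪ σ ∣ ι x - a , ι y - b ⟫ ≡ ι ⟨ σ ∣ q i ⟩ - κ σ
      ⟪⟫≡ σ i = let (x , y) = q i in
        trans (⟪⟫-minus σ (ι x) (ι y) a b) (cong (_- κ σ) (sym (ι-⟨⟩ σ (q i))))

      ≤radius : ∀ σ i → ι ⟨ σ ∣ q i ⟩ - κ σ ℚ.≤ radius i
      ≤radius σ i = let (x , y) = q i in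
        subst (ℚ._≤ radius i) (⟪⟫≡ σ i) (⟪⟫-≤ σ (ι x - a) (ι y - b))

      -- The centre `(a , b)` is rational, so the signs of the coordinate differences are decidable
      -- and a direction attaining the norm can be chosen.
      active : ∀ i → ∃[ σ ] radius i ≡ ι ⟨ σ ∣ q i ⟩ - κ σ
      active i =
        let (x , y) = q i
            (σ , e) = ⟪⟫-attained (ι x - a) (ι y - b)
        in σ , trans e (⟪⟫≡ σ i)

      exceeded : ∀ σ i → radius i ≡ ι ⟨ σ ∣ q i ⟩ - κ σ → Exceeded σ i →
        ∃[ j ] radius i + 1ℚ ℚ.≤ radius j
      exceeded σ i e (j , lt) = j , (begin
        radius i + 1ℚ                  ≡⟨ cong (_+ 1ℚ) e ⟩
        ι ⟨ σ ∣ q i ⟩ - κ σ + 1ℚ        ≡⟨ swap (ι ⟨ σ ∣ q i ⟩) (κ σ) 1ℚ ⟩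
        ι ⟨ σ ∣ q i ⟩ + 1ℚ - κ σ        ≤⟨ ℚ.+-monoˡ-≤ (- κ σ) (ι-gap lt) ⟩
        ι ⟨ σ ∣ q j ⟩ - κ σ             ≤⟨ ≤radius σ j ⟩
        radius j                       ∎)
        where
        open ℚ.≤-Reasoning
        open +-*-Solver
        swap : ∀ x y z → x - y + z ≡ x + z - y
        swap = solve 3 (λ x y z → x :- y :+ z := x :+ z :- y) refl

      -- Opposite directions see the centre with opposite signs, so it cancels.
      opposite-sum : ∀ σ u v → (u - κ σ) + (v - κ (opp σ)) ≡ u + v
      opposite-sum σ u v rewrite ⟪⟫-opp σ (a , b) =
        solve 3 (λ u v k → (u :- k) :+ (v :- (:- k)) := u :+ v) refl u v (κ σ)
        where open +-*-Solver

      -- With opposite active directions the radii of `i` and `k` add up exactly to their width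
      -- along `σ`, whatever the centre. For `j` and `l` the width along `ρ` is a lower bound of the
      -- sum.
      narrow : ∀ σ i k → radius i ≡ ι ⟨ σ ∣ q i ⟩ - κ σ →
        radius k ≡ ι ⟨ opp σ ∣ q k ⟩ - κ (opp σ) → Narrow σ i k →
        ∃[ j ] ∃[ l ] radius i + radius k + 1ℚ ℚ.≤ radius j + radius l
      narrow σ i k eᵢ eₖ (ρ , j , l , lt) = j , l , (begin
        radius i + radius k + 1ℚ
          ≡⟨ cong (_+ 1ℚ) (trans (cong₂ _+_ eᵢ eₖ)
               (opposite-sum σ (ι ⟨ σ ∣ q i ⟩) (ι ⟨ opp σ ∣ q k ⟩))) ⟩
        ι ⟨ σ ∣ q i ⟩ + ι ⟨ opp σ ∣ q k ⟩ + 1ℚ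
          ≡⟨ cong (_+ 1ℚ) (sym (ι-+ ⟨ σ ∣ q i ⟩ ⟨ opp σ ∣ q k ⟩)) ⟩
        ι (⟨ σ ∣ q i ⟩ ℤ.+ ⟨ opp σ ∣ q k ⟩) + 1ℚ
          ≤⟨ ι-gap lt ⟩
        ι (⟨ ρ ∣ q j ⟩ ℤ.+ ⟨ opp ρ ∣ q l ⟩)
          ≡⟨ ι-+ ⟨ ρ ∣ q j ⟩ ⟨ opp ρ ∣ q l ⟩ ⟩
        ι ⟨ ρ ∣ q j ⟩ + ι ⟨ opp ρ ∣ q l ⟩
          ≡⟨ sym (opposite-sum ρ (ι ⟨ ρ ∣ q j ⟩) (ι ⟨ opp ρ ∣ q l ⟩)) ⟩
        (ι ⟨ ρ ∣ q j ⟩ - κ ρ) + (ι ⟨ opp ρ ∣ q l ⟩ - κ (opp ρ))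
          ≤⟨ ℚ.+-mono-≤ (≤radius ρ j) (≤radius (opp ρ) l) ⟩
        radius j + radius l ∎)
        where open ℚ.≤-Reasoning

      -- Pads a gap between two single radii with `radius i`, so that the exceeded cases also fit
      -- `RadiusGap`.
      shift : ∀ i k l → radius k + 1ℚ ℚ.≤ radius l →
        radius i + radius k + 1ℚ ℚ.≤ radius i + radius l
      shift i k l le = subst (ℚ._≤ radius i + radius l)
        (sym (ℚ.+-assoc (radius i) (radius k) 1ℚ)) (ℚ.+-monoʳ-≤ (radius i) le)

    -- The gap 1 does not depend on the centre, so this can be applied to one term of the Cauchy
    -- sequences of a real centre.
    RadiusGap : Set
    RadiusGap = ∃[ i ] ∃[ k ] ∃[ j ] ∃[ l ]
      radius i + radius k + 1ℚ ℚ.≤ radius j + radius l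

    radius-gap : NonConcyclic → RadiusGap
    radius-gap (i , k , h) = from-active (active i) (active k)
      where
      from-active : ∃[ σ ] radius i ≡ ι ⟨ σ ∣ q i ⟩ - κ σ →
        ∃[ τ ] radius k ≡ ι ⟨ τ ∣ q k ⟩ - κ τ → RadiusGap
      from-active (σ , eᵢ) (τ , eₖ) =
        [ (λ ex → let (j , le) = exceeded σ i eᵢ ex in i , i , i , j , shift i i j le)
        , (λ h′ →
            [ (λ ex → let (l , le) = exceeded τ k eₖ ex in i , k , i , l , shift i k l le)
            , opposite {τ} eₖ ]′ (h′ τ)) ]′ (h σ)
        where
        opposite : ∀ {τ} → radius k ≡ ι ⟨ τ ∣ q k ⟩ - κ τ →
          τ ≡ opp σ × Narrow σ i k → RadiusGap
        opposite eₖ (refl , nar) =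
          let (j , l , le) = narrow σ i k eᵢ eₖ nar in i , k , j , l , le

-- Takes the maximum of finitely many thresholds, so that all points of a circle can be compared at
-- a single index.
eventually-all : ∀ {m} {P : Fin m → ℕ → Set} →
  (∀ i → ∃[ N ] (∀ n → N ℕ.≤ n → P i n)) → ∃[ N ] (∀ n → N ℕ.≤ n → ∀ i → P i n)
eventually-all {zero} h = 0 , λ _ _ ()
eventually-all {suc m} h =
  let (M , f) = h zero
      (N , g) = eventually-all (h ∘ suc)
  in M ℕ.⊔ N , λ n le → λ where
    zero    → f n (ℕ.m⊔n≤o⇒m≤o M N le)
    (suc i) → g n (ℕ.m⊔n≤o⇒n≤o M N le) i

within⇒< : ∀ {p q ε} → ∣ p - q ∣ ℚ.< ε → p ℚ.< ε + q
within⇒< {p} {q} {ε} lt = subst (ℚ._< ε + q) (Estimates.cancel p q)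
  (ℚ.+-monoˡ-< q (ℚ.≤-<-trans (p≤∣p∣ (p - q)) lt))

-- At a late index `N` every rational radius lies within `ε` of the term `r` of the real radius. Two
-- sums of two radii then differ by less than 1, against `radius-gap`.
nonConcyclic⇒notOnCircle : ∀ {m} (q : Fin m → ℤ²) → NonConcyclic q →
  (C : Circle) → ¬ (∀ i → OnCircle C (embed (q i)))
nonConcyclic⇒notOnCircle q nc C on =
  let (N , near) = eventually-all λ i → _≈_.close (on i) ε (ℚ.positive⁻¹ ε)
      (i , k , j , l , gap) = radius-gap q (seq a N) (seq b N) nc
      R = radius q (seq a N) (seq b N)
      r = seq (Circle.radius C) N
      R<r = λ i → within⇒< {R i} {r} (near N ℕ.≤-refl i)
      r<R = λ i → within⇒< {r} {R i}
        (subst (ℚ._< ε) (Estimates.abs-sym (R i) r) (near N ℕ.≤-refl i))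
  in ℚ.<-irrefl refl $ begin-strict
       R j + R l
         <⟨ ℚ.+-mono-< (R<r j) (R<r l) ⟩
       (ε + r) + (ε + r)
         <⟨ ℚ.+-mono-< (ℚ.+-monoʳ-< ε (r<R i)) (ℚ.+-monoʳ-< ε (r<R k)) ⟩
       (ε + (ε + R i)) + (ε + (ε + R k))
         ≡⟨ four-quarters (R i) (R k) ⟩
       R i + R k + 1ℚ
         ≤⟨ gap ⟩
       R j + R l ∎
  where
  open ℚ.≤-Reasoning
  open +-*-Solver
  a b : ℝ
  a = proj₁ (Circle.centre C)
  b = proj₂ (Circle.centre C)
  -- A quarter, because four comparisons with `r` have to fit into the gap of 1.
  ε : ℚ
  ε = ½ * ½
  four-quarters : ∀ x y → (ε + (ε + x)) + (ε + (ε + y)) ≡ x + y + 1ℚ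
  four-quarters = solve 2 (λ x y →
    (con ε :+ (con ε :+ x)) :+ (con ε :+ (con ε :+ y)) := x :+ y :+ con 1ℚ) refl

-- Decidability of the circle criterion

∀Sign? : {P : Sign → Set} → Decidable P → Dec (∀ s → P s)
∀Sign? P? = map′ (λ { (p , q) Sign.+ → p ; (p , q) Sign.- → q })
  (λ f → f Sign.+ , f Sign.-) (P? Sign.+ ×-dec P? Sign.-)

∃Sign? : {P : Sign → Set} → Decidable P → Dec (∃ P)
∃Sign? P? = map′ [ (Sign.+ ,_) , (Sign.- ,_) ]′
  (λ { (Sign.+ , p) → inj₁ p ; (Sign.- , p) → inj₂ p }) (P? Sign.+ ⊎-dec P? Sign.-)

∀Direction? : {P : Direction → Set} → Decidable P → Dec (∀ σ → P σ)
∀Direction? P? = map′ (λ f (s , t) → f s t) (λ f s t → f (s , t))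
  (∀Sign? λ s → ∀Sign? λ t → P? (s , t))

∃Direction? : {P : Direction → Set} → Decidable P → Dec (∃ P)
∃Direction? P? = map′ (λ (s , t , p) → (s , t) , p) (λ ((s , t) , p) → s , t , p)
  (∃Sign? λ s → ∃Sign? λ t → P? (s , t))

nonConcyclic? : ∀ {m} (q : Fin m → ℤ²) → Dec (NonConcyclic q)
nonConcyclic? q = Fin.any? λ i → Fin.any? λ k → ∀Direction? λ σ →
  exceeded? σ i ⊎-dec ∀Direction? λ τ → exceeded? τ k ⊎-dec
    (≡-dec Sign._≟_ Sign._≟_ τ (opp σ) ×-dec narrow? σ i k)
  where
  exceeded? : ∀ σ i → Dec (Exceeded q σ i)
  exceeded? σ i = Fin.any? λ j → ⟨ σ ∣ q i ⟩ ℤ.<? ⟨ σ ∣ q j ⟩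
  narrow? : ∀ σ i k → Dec (Narrow q σ i k)
  narrow? σ i k = ∃Direction? λ ρ → Fin.any? λ j → Fin.any? λ l →
    ⟨ σ ∣ q i ⟩ ℤ.+ ⟨ opp σ ∣ q k ⟩ ℤ.<? ⟨ ρ ∣ q j ⟩ ℤ.+ ⟨ opp ρ ∣ q l ⟩

-- Multiplicities

lookup-injective : ∀ {A : Set} {xs : List A} → Unique xs →
  Injective _≡_ _≡_ (List.lookup xs)
lookup-injective (_  ∷ _) {zero}  {zero}  _ = refl
lookup-injective (x∉ ∷ _) {zero}  {suc j} e = ⊥-elim (All.lookup x∉ (∈-lookup j) e)
lookup-injective (x∉ ∷ _) {suc i} {zero}  e = ⊥-elim (All.lookup x∉ (∈-lookup i) (sym e))
lookup-injective (_  ∷ u) {suc i} {suc j} e = cong suc (lookup-injective u e)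

unique-list⇒HasExactly : ∀ {A : Set} {P : A → Set} {xs : List A} → Unique xs →
  (∀ x → P x ⇔ x ∈ xs) → HasExactly (setoid A) (length xs) P
unique-list⇒HasExactly {P = P} {xs} u P⇔∈ = List.lookup xs , lookup-injective u , λ x → mk⇔
  (λ Px → let x∈xs = Equivalence.to (P⇔∈ x) Px in index x∈xs , sym (lookup-index x∈xs))
  (λ (i , e) → subst P e (Equivalence.from (P⇔∈ _) (∈-lookup i)))

∈-nonempty : ∀ {A : Set} {xs : List A} {k} → length xs ≡ suc k → ∃[ x ] x ∈ xs
∈-nonempty {xs = x ∷ _} _ = x , here refl

module _ {n} (p : Fin n → ℤ²) where
  AtDistance : ℕ → Fin n × Fin n → Set
  AtDistance d (i , j) = i Fin.< j × δ (p i) (p j) ≡ d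

  atDistance? : ∀ d → Decidable (AtDistance d)
  atDistance? d (i , j) = i Fin.<? j ×-dec δ (p i) (p j) ℕ.≟ d

  pairs : List (Fin n × Fin n)
  pairs = cartesianProduct (allFin n) (allFin n)

  pairsAt : ℕ → List (Fin n × Fin n)
  pairsAt d = filter (atDistance? d) pairs

  -- Filtering the repetition-free list of all index pairs gives the required enumeration, so a
  -- multiplicity becomes a computable list length.
  pairsAt-multiplicity : ∀ d →
    HasMultiplicity (embed ∘ p) (fromℚ (ι (+ d))) (length (pairsAt d))
  pairsAt-multiplicity d = unique-list⇒HasExactly
    (filter⁺ (atDistance? d) (cartesianProduct⁺ (allFin⁺ n) (allFin⁺ n)))
    λ (i , j) → mk⇔
      (λ (i<j , e) → ∈-filter⁺ (atDistance? d)
        (∈-cartesianProduct⁺ (∈-allFin i) (∈-allFin j)) (i<j , dist≈⇒δ≡ (p i) (p j) e))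
      (λ ij∈ → let (i<j , e) = proj₂ (∈-filter⁻ (atDistance? d) {xs = pairs} ij∈)
               in i<j , δ≡⇒dist≈ (p i) (p j) e)

-- Integer crescents

-- Distances are indexed by multiplicity: `d k` occurs `k + 1` times. All fields are bounded
-- quantifications over decidable facts.
record IntegerCrescent {n} (p : Fin n → ℤ²) (d : Fin (n ∸ 1) → ℕ) : Set where
  constructor integerCrescent
  field
    injective    : ∀ i j → p i ≡ p j → i ≡ j
    noncollinear : ∀ i j k → Unique (i ∷ j ∷ k ∷ []) → det (p i) (p j) (p k) ≢ + 0
    nonconcyclic : ∀ i j k l → Unique (i ∷ j ∷ k ∷ l ∷ []) →
      NonConcyclic (p ∘ Vec.lookup (i ∷ j ∷ k ∷ l ∷ []))
    -- Consequences of a line-like labelling in the order `i`, `j`, `k`, `l`: the three gaps of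
    -- length one agree, and so do the two of length two. Every order of the four points is covered.
    nonlinelike  : ∀ i j k l → Unique (i ∷ j ∷ k ∷ l ∷ []) →
      ¬ (δ (p i) (p j) ≡ δ (p j) (p k) × δ (p j) (p k) ≡ δ (p k) (p l) ×
         δ (p i) (p k) ≡ δ (p j) (p l))
    complete     : ∀ i j → i ≢ j → ∃[ k ] d k ≡ δ (p i) (p j)
    multiplicity : ∀ k → length (pairsAt p (d k)) ≡ suc (toℕ k)

integerCrescent? : ∀ {n} (p : Fin n → ℤ²) d → Dec (IntegerCrescent p d)
integerCrescent? p d = map′
  (λ (a , b , c , e , f , g) → integerCrescent a b c e f g)
  (λ (integerCrescent a b c e f g) → a , b , c , e , f , g)
  ( (Fin.all? λ i → Fin.all? λ j → ≡-dec ℤ._≟_ ℤ._≟_ (p i) (p j) →-dec i Fin.≟ j)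
  ×-dec (Fin.all? λ i → Fin.all? λ j → Fin.all? λ k →
    unique? Fin._≟_ (i ∷ j ∷ k ∷ []) →-dec ¬? (det (p i) (p j) (p k) ℤ.≟ + 0))
  ×-dec (Fin.all? λ i → Fin.all? λ j → Fin.all? λ k → Fin.all? λ l →
    unique? Fin._≟_ (i ∷ j ∷ k ∷ l ∷ []) →-dec
    nonConcyclic? (p ∘ Vec.lookup (i ∷ j ∷ k ∷ l ∷ [])))
  ×-dec (Fin.all? λ i → Fin.all? λ j → Fin.all? λ k → Fin.all? λ l →
    unique? Fin._≟_ (i ∷ j ∷ k ∷ l ∷ []) →-dec
    ¬? (δ (p i) (p j) ℕ.≟ δ (p j) (p k) ×-dec δ (p j) (p k) ℕ.≟ δ (p k) (p l)
      ×-dec δ (p i) (p k) ℕ.≟ δ (p j) (p l)))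
  ×-dec (Fin.all? λ i → Fin.all? λ j → ¬? (i Fin.≟ j) →-dec
    Fin.any? λ k → d k ℕ.≟ δ (p i) (p j))
  ×-dec (Fin.all? λ k → length (pairsAt p (d k)) ℕ.≟ suc (toℕ k)))

-- From integer crescents to strong crescents

module _ {n} {p : Fin n → ℤ²} {d : Fin (n ∸ 1) → ℕ} (crescent : IntegerCrescent p d) where
  open IntegerCrescent crescent

  private
    S : Fin n → ℝ²
    S = embed ∘ p

  -- Reordering the points by the inverse of `φ` puts them at positions 0, 1, 2, 3, where equal
  -- index gaps give the forbidden equal distances.
  nonlinelike⇒¬LineLike : (s : Fin 4 → Fin n) → Injective _≡_ _≡_ s → ¬ LineLike (S ∘ s)
  nonlinelike⇒¬LineLike s s-inj (φ , h) = nonlinelike (t 0F) (t 1F) (t 2F) (t 3F)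
    (tabulate⁺ {f = t} t-inj)
    ( δ≡δ 0F 1F 1F 2F refl
    , δ≡δ 1F 2F 2F 3F refl
    , δ≡δ 0F 2F 1F 3F refl)
    where
    t : Fin 4 → Fin n
    t k = s (φ ⟨$⟩ˡ k)
    t-inj : Injective _≡_ _≡_ t
    t-inj e = trans (sym (inverseʳ φ)) (trans (cong (φ ⟨$⟩ʳ_) (s-inj e)) (inverseʳ φ))
    gap : ∀ k l →
      ℕ.∣ toℕ (φ ⟨$⟩ʳ (φ ⟨$⟩ˡ k)) - toℕ (φ ⟨$⟩ʳ (φ ⟨$⟩ˡ l)) ∣ ≡ ℕ.∣ toℕ k - toℕ l ∣
    gap k l = cong₂ (λ a b → ℕ.∣ toℕ a - toℕ b ∣) (inverseʳ φ) (inverseʳ φ)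
    δ≡δ : ∀ a b c e → ℕ.∣ toℕ a - toℕ b ∣ ≡ ℕ.∣ toℕ c - toℕ e ∣ →
      δ (p (t a)) (p (t b)) ≡ δ (p (t c)) (p (t e))
    δ≡δ a b c e eq = dist≈dist⇒δ≡δ (p (t a)) (p (t b)) (p (t c)) (p (t e))
      (Equivalence.from (h _ _ _ _) (trans (gap a b) (trans eq (sym (gap c e)))))

  -- Equal distances would have equal multiplicities, and these determine the index.
  d-injective : Injective _≡_ _≡_ d
  d-injective {k} {l} e = Fin.toℕ-injective (ℕ.suc-injective
    (trans (sym (multiplicity k)) (trans (cong (length ∘ pairsAt p) e) (multiplicity l))))

  d-attained : ∀ k → IsDistance S (fromℚ (ι (+ d k)))
  d-attained k =
    let ((i , j) , ij∈) = ∈-nonempty {xs = pairsAt p (d k)} (multiplicity k)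
        (i<j , e) = proj₂ (∈-filter⁻ (atDistance? p (d k)) {xs = pairs p} ij∈)
    in i , j , Fin.<⇒≢ i<j , δ≡⇒dist≈ (p i) (p j) e

  strongCrescent : StrongCrescent n S
  strongCrescent = record
    { distinct   = λ e → injective _ _ (embed-injective e)
    ; generalPos = record
      { noThreeOnLine = λ s s-inj (ℓ , on) →
          det≢0⇒noncollinear (p (s 0F)) (p (s 1F)) (p (s 2F))
            (noncollinear _ _ _ (tabulate⁺ {f = s} s-inj)) ℓ (on 0F) (on 1F) (on 2F)
      ; noFourOnCircle = λ s s-inj (C , on) → nonConcyclic⇒notOnCircle _
          -- The lookup in the list of values of `s` reduces to `s` only at literal indices, hence
          -- the case split that follows.
          (nonconcyclic _ _ _ _ (tabulate⁺ {f = s} s-inj)) C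
          λ { 0F → on 0F ; 1F → on 1F ; 2F → on 2F ; 3F → on 3F }
      ; noFourLineLike = nonlinelike⇒¬LineLike
      }
    ; distances =
        (λ k → fromℚ (ι (+ d k))) , (λ e → d-injective (fromℕ-injective e)) , λ x → mk⇔
          (λ (i , j , i≢j , e) →
            let (k , dₖ≡δ) = complete i j i≢j
            in k , ≈.trans (≈.sym (δ≡⇒dist≈ (p i) (p j) (sym dₖ≡δ))) e)
          (λ (k , dₖ≈x) →
            let (i , j , i≢j , e) = d-attained k
            in i , j , i≢j , ≈.trans e dₖ≈x)
    ; multiplicities = λ where
        -- The bound `suc m ≤ n ∸ 1` is by definition `m < n ∸ 1`, so `m` is the index of the
        -- distance occurring `suc m` times.
        (suc m) _ m<n∸1 →
          let k = fromℕ< m<n∸1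
          in fromℚ (ι (+ d k)) , d-attained k ,
             subst (HasMultiplicity S (fromℚ (ι (+ d k))))
               (trans (multiplicity k) (cong suc (Fin.toℕ-fromℕ< m<n∸1)))
               (pairsAt-multiplicity p (d k))
    }

-- For literal points the implicit `True` argument is solved by evaluating the decision procedure
-- during type checking.
crescent-from : ∀ {n} (ps : Vec ℤ² n) (ds : Vec ℕ (n ∸ 1)) →
  {True (integerCrescent? (Vec.lookup ps) (Vec.lookup ds))} → ∃[ S ] StrongCrescent n S
crescent-from ps ds {c} = _ , strongCrescent {d = Vec.lookup ds} (toWitness c)

-- The point sets were found by simulated annealing over small integer grids.
corollary1p10 : (n : ℕ) → 1 ≤ n → n ≤ 8 → ∃[ S ] StrongCrescent n S
corollary1p10 1 _ _ = crescent-from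
  ((+ 0 , + 0) ∷ [])
  []
corollary1p10 2 _ _ = crescent-from
  ((+ 0 , + 0) ∷ (+ 1 , + 0) ∷ [])
  (1 ∷ [])
corollary1p10 3 _ _ = crescent-from
  ((+ 4 , + 3) ∷ (+ 0 , + 3) ∷ (+ 1 , + 0) ∷ [])
  (6 ∷ 4 ∷ [])
corollary1p10 4 _ _ = crescent-from
  ((+ 8 , + 1) ∷ (+ 0 , + 3) ∷ (+ 3 , + 0) ∷ (+ 5 , + 6) ∷ [])
  -- In order of multiplicity: 10 occurs once, 6 twice, 8 three times.
  (10 ∷ 6 ∷ 8 ∷ [])
corollary1p10 5 _ _ = crescent-from
  ((+ 10 , + 0) ∷ (+ 2 , + 2) ∷ (+ 3 , + 1) ∷ (+ 5 , + 3) ∷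
   (+ 0 , + 0) ∷ [])
  (2 ∷ 10 ∷ 8 ∷ 4 ∷ [])
corollary1p10 6 _ _ = crescent-from
  ((+ 5 , + 3) ∷ (+ 4 , + 0) ∷ (+ 1 , + 7) ∷ (+ 4 , + 6) ∷
   (+ 3 , + 11) ∷ (+ 0 , + 4) ∷ [])
  (12 ∷ 8 ∷ 10 ∷ 4 ∷ 6 ∷ [])
corollary1p10 7 _ _ = crescent-from
  ((+ 8 , + 6) ∷ (+ 5 , + 11) ∷ (+ 8 , + 4) ∷ (+ 3 , + 7) ∷
   (+ 0 , + 6) ∷ (+ 6 , + 0) ∷ (+ 4 , + 4) ∷ [])
  (2 ∷ 12 ∷ 4 ∷ 10 ∷ 8 ∷ 6 ∷ [])
corollary1p10 8 _ _ = crescent-from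
  ((+ 1 , + 0) ∷ (+ 0 , + 5) ∷ (+ 2 , + 9) ∷ (+ 3 , + 4) ∷
   (+ 0 , + 3) ∷ (+ 5 , + 4) ∷ (+ 8 , + 3) ∷ (+ 2 , + 11) ∷ [])
  (14 ∷ 12 ∷ 2 ∷ 4 ∷ 10 ∷ 8 ∷ 6 ∷ [])
corollary1p10 (suc (suc (suc (suc (suc (suc (suc (suc (suc _))))))))) _
  (s≤s (s≤s (s≤s (s≤s (s≤s (s≤s (s≤s (s≤s ()))))))))
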